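{- Let $V$ be a finite set and let $A=(A_{xy})$ be a real symmetric matrix indexed by $V$. Then $A$ has a perfect elimination ordering if and only if $A$ has no self-contained pair of weighted chordless walks, i.e., there do not exist two weighted chordless walks $W_1,W_2$ in $A$ with $V(W_1)\cup V(W_2)=I(W_1)\cup I(W_2)$.
   Context: A perfect elimination ordering of $A$ is a linear order $\pi$ of $V$ such that $A_{yz}\ge \min\{A_{xy},A_{xz}\}$ for all $x,y,z\in V$ with $x<_\pi y<_\pi z$ (diagonal entries play no role). A walk is an ordered sequence $W=(v_0,v_1,\dots,v_p)$ ($p\ge 1$) of elements of $V$ (repetitions allowed); $V(W)=\{v_0,\dots,v_p\}$ and $I(W)=\{v_i:1\le i\le p-1\}$ is the set of internal elements. $W$ is weighted chordless in $A$ if $A_{v_{i-1}v_{i+1}}<\min\{A_{v_{i-1}v_i},A_{v_{i+1}v_i}\}$ for all $1\le i\le p-1$. A family $\{W_1,\dots,W_k\}$ of walks is self-contained if $\bigcup_h V(W_h)=\bigcup_h I(W_h)$.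
   Formalization: A weighted chordless walk is additionally required to have v_{i-1} ≠ v_{i+1} at each internal position (diagonal entries ignored); otherwise (u,v,u), (v,u,v) with A_uu = A_vv = 0, A_uv = 1 refute the claim. -}

module Defs where

open import Data.Fin.Base using (Fin; suc; inject₁)
open import Data.Nat.Base as ℕ using (ℕ)
open import Data.Product.Base using (_×_; _,_; ∃; Σ-syntax; proj₁; proj₂)
open import Data.Rational.Base as ℚ using (ℚ)
import Data.Rational.Properties as ℚₚ
open import Data.Sum.Base as Sum using (_⊎_; inj₁; inj₂; [_,_]′)
open import Function.Bundles using (_↔_)
open import Level using (0ℓ)
open import Relation.Binary.Core using (Rel)
open import Relation.Binary.PropositionalEquality.Core using (_≡_; _≢_; refl)
open import Relation.Binary.Structures using (IsStrictTotalOrder)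
open import Relation.Nullary.Negation.Core using (¬_)
open import Relation.Unary using (Pred; _∪_; _∩_; _≐_)

-- Real numbers as two-sided Dedekind cuts of ℚ: `L q` says that q is
-- strictly below the real, `U q` that q is strictly above it.

record ℝ : Set₁ where
  field
    L U       : Pred ℚ 0ℓ
    inhabited : ∃ L × ∃ U
    L-open    : ∀ {q} → L q → ∃ λ r → q ℚ.< r × L r
    L-down    : ∀ {q r} → q ℚ.< r → L r → L q
    U-open    : ∀ {r} → U r → ∃ λ q → q ℚ.< r × U q
    U-up      : ∀ {q r} → q ℚ.< r → U q → U r
    disjoint  : ∀ {q} → ¬ (L q × U q)
    located   : ∀ {q r} → q ℚ.< r → L q ⊎ U r

open ℝ

infix 4 _≤_ _<_ _≃_

_≤_ : Rel ℝ 0ℓ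
x ≤ y = ∀ {q} → L x q → L y q

_<_ : Rel ℝ 0ℓ
x < y = ∃ λ q → U x q × L y q

-- Equality of reals; propositional equality of cuts would be too fine.
_≃_ : Rel ℝ 0ℓ
x ≃ y = x ≤ y × y ≤ x

infixl 7 _⊓_

_⊓_ : ℝ → ℝ → ℝ
x ⊓ y = record
  { L         = L x ∩ L y
  ; U         = U x ∪ U y
  ; inhabited = below (proj₁ (inhabited x)) (proj₁ (inhabited y))
              , (proj₁ (proj₂ (inhabited x)) , inj₁ (proj₂ (proj₂ (inhabited x))))
  ; L-open    = open∩
  ; L-down    = λ q<r (lx , ly) → L-down x q<r lx , L-down y q<r ly
  ; U-open    = [ (λ ux → let (q , q<r , u) = U-open x ux in q , q<r , inj₁ u)
                , (λ uy → let (q , q<r , u) = U-open y uy in q , q<r , inj₂ u) ]′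
  ; U-up      = λ q<r → Sum.map (U-up x q<r) (U-up y q<r)
  ; disjoint  = λ { ((lx , ly) , inj₁ ux) → disjoint x (lx , ux)
                  ; ((lx , ly) , inj₂ uy) → disjoint y (ly , uy) }
  ; located   = located∩
  }
  where
  open import Relation.Binary.Definitions using (tri<; tri≈; tri>)

  -- Of two elements of L x and L y, the smaller lies in both.
  smaller : ∀ {p r} → L x p → L y r →
            (p ≡ r ⊎ p ℚ.< r) × (L x ∩ L y) p ⊎ r ℚ.< p × (L x ∩ L y) r
  smaller {p} {r} lx ly with ℚₚ.<-cmp p r
  ... | tri< p<r _ _  = inj₁ (inj₂ p<r , lx , L-down y p<r ly)
  ... | tri≈ _ refl _ = inj₁ (inj₁ refl , lx , ly)
  ... | tri> _ _ r<p  = inj₂ (r<p , L-down x r<p lx , ly)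

  below : ∃ (L x) → ∃ (L y) → ∃ (L x ∩ L y)
  below (p , lx) (r , ly) with smaller lx ly
  ... | inj₁ (_ , l) = p , l
  ... | inj₂ (_ , l) = r , l

  open∩ : ∀ {q} → (L x ∩ L y) q → ∃ λ r → q ℚ.< r × (L x ∩ L y) r
  open∩ (lx , ly) with L-open x lx | L-open y ly
  ... | p , q<p , lx′ | r , q<r , ly′ with smaller lx′ ly′
  ...   | inj₁ (_ , l) = p , q<p , l
  ...   | inj₂ (_ , l) = r , q<r , l

  located∩ : ∀ {q r} → q ℚ.< r → (L x ∩ L y) q ⊎ (U x ∪ U y) r
  located∩ q<r with located x q<r | located y q<r
  ... | inj₂ ux | _       = inj₂ (inj₁ ux)
  ... | inj₁ _  | inj₂ uy = inj₂ (inj₂ uy)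
  ... | inj₁ lx | inj₁ ly = inj₁ (lx , ly)

x⊓y≤x : ∀ x y → x ⊓ y ≤ x
x⊓y≤x x y = proj₁

x⊓y≤y : ∀ x y → x ⊓ y ≤ y
x⊓y≤y x y = proj₂

⊓-glb : ∀ {x y z} → z ≤ x → z ≤ y → z ≤ x ⊓ y
⊓-glb z≤x z≤y lz = z≤x lz , z≤y lz

Finite : Set → Set
Finite V = ∃ λ n → V ↔ Fin n

Matrix : Set → Set₁
Matrix V = V → V → ℝ

module _ {V : Set} where

  Symmetric : Matrix V → Set
  Symmetric A = ∀ x y → A x y ≃ A y x

  PerfectElimination : Matrix V → Rel V 0ℓ → Set
  PerfectElimination A _≺_ =
    ∀ x y z → x ≺ y → y ≺ z → A x y ⊓ A x z ≤ A y z

  HasPerfectEliminationOrdering : Matrix V → Set₁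
  HasPerfectEliminationOrdering A =
    ∃ λ (_≺_ : Rel V 0ℓ) →
      IsStrictTotalOrder _≡_ _≺_ × PerfectElimination A _≺_

-- (v₀, v₁, …, v_p) with p = 1 + internals, so p ≥ 1 and the internal
-- positions 1, …, p - 1 are in bijection with Fin internals.
record Walk (V : Set) : Set where
  field
    internals : ℕ
    vertex    : Fin (2 ℕ.+ internals) → V

  -- For the internal position i, written here as an element of
  -- Fin internals: v_{i-1}, v_i and v_{i+1}.
  prev here next : Fin internals → V
  prev i = vertex (inject₁ (inject₁ i))
  here i = vertex (suc (inject₁ i))
  next i = vertex (suc (suc i))

module _ {V : Set} where

  open Walk

  V[_] : Walk V → Pred V 0ℓ
  V[ W ] x = ∃ λ i → vertex W i ≡ x

  I[_] : Walk V → Pred V 0ℓ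
  I[ W ] x = ∃ λ i → here W i ≡ x

  -- Diagonal entries of A play no role, i.e. A_xx counts as +∞: the
  -- inequality fails when v_{i-1} = v_{i+1}, whatever value A has there.
  -- Otherwise (u, v, u) and (v, u, v) could form a self-contained pair of
  -- weighted chordless walks in a 2 × 2 matrix.  The two entries under the
  -- minimum need no such proviso: if v_i equals v_{i-1} or v_{i+1}, the
  -- inequality already fails for symmetric A.
  WeightedChordless : Matrix V → Walk V → Set
  WeightedChordless A W = ∀ i →
    prev W i ≢ next W i ×
    A (prev W i) (next W i) < A (prev W i) (here W i) ⊓ A (next W i) (here W i)

  SelfContained : Walk V → Walk V → Set
  SelfContained W₁ W₂ = (V[ W₁ ] ∪ V[ W₂ ]) ≐ (I[ W₁ ] ∪ I[ W₂ ])

  HasSelfContainedPair : Matrix V → Set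
  HasSelfContainedPair A = Σ[ W₁ ∈ Walk V ] Σ[ W₂ ∈ Walk V ]
    WeightedChordless A W₁ × WeightedChordless A W₂ × SelfContained W₁ W₂

{-# OPTIONS --safe #-}
module Submission where

-- In a perfect elimination ordering, the first vertex of a self-contained
-- family would be internal, and chordlessness there contradicts perfection.
--
-- Conversely, assume that there is no self-contained pair.  By induction on the
-- size of a disjoint union S = C ∪ X one shows: if C is nonempty and no vertex of C is simplicial
-- in A[S], then some chordless walk starts and ends in X and has its second and
-- penultimate vertices in C; with X = ∅ this says that A[S] has a simplicial
-- vertex.  Let E be the graph of the entries exceeding the least off-diagonal
-- entry of A[S].  If all of C is universal in E, a pair attaining that least
-- entry lies in X and forms a walk with any vertex of C between.  Otherwise take
-- a ∈ C and b non-adjacent to it, a minimal separator Q between them and the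
-- components K, K′ of a and b.  Chordless triples centred in K lie in K ∪ Q, so the
-- induction hypothesis for C ∩ K and (X ∩ K) ∪ Q gives a walk τ, and likewise
-- τ′ for K′.  A walk leaving K through Q can be continued along an induced path
-- of E in K′.  If X meets K′, then τ is thus prolonged to X, and symmetrically
-- for τ′; if X meets neither, prolonging τ at both ends to an internal vertex
-- of τ′, and τ′ to an internal vertex of τ, gives a self-contained pair.

open import Defs
open import Axiom.ExcludedMiddle using (ExcludedMiddle)
open import Data.Fin.Base using (Fin; zero; suc; inject₁; punchIn; punchOut)
open import Data.Fin.Induction using (spo-wellFounded)
open import Data.Fin.Properties using (punchIn-punchOut; *↔×)
open import Data.Nat.Base as ℕ using (ℕ; zero; suc)
import Data.Nat.Properties as ℕₚ
open import Data.Product.Base using (_×_; _,_; ∃; ∃₂; proj₁; proj₂)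
open import Data.Product.Function.NonDependent.Propositional using (_×-↔_)
import Data.Rational.Properties as ℚₚ
open import Data.Sum.Base using (_⊎_; inj₁; inj₂; [_,_]′)
open import Data.Unit.Base using (⊤; tt)
open import Function.Base using (_∘_; id)
open import Function.Bundles using (_⇔_; mk⇔; module Inverse)
open import Function.Properties.Inverse using (↔-sym; ↔-trans)
open import Induction.WellFounded using (WellFounded; Acc; acc)
open import Level using (0ℓ)
open import Relation.Binary.Core using (Rel)
open import Relation.Binary.Construct.Closure.ReflexiveTransitive
  using (Star; ε; _◅_; _◅◅_; reverse)
open import Relation.Binary.Definitions using (tri<; tri≈; tri>; Irreflexive; Transitive)
open import Relation.Binary.PropositionalEquality
  using (_≡_; _≢_; refl; sym; cong; subst; isEquivalence)
open import Relation.Binary.Structures using (IsStrictTotalOrder)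
open import Relation.Nullary.Decidable.Core using (Dec; yes; no; decidable-stable)
open import Relation.Nullary.Negation.Core using (¬_; contradiction)
open import Relation.Unary using (Pred; _∪_; _∩_; _⊆_; ∅)

open ℝ

-- Order properties of Dedekind reals.

<-≤-trans : ∀ x y z → x < y → y ≤ z → x < z
<-≤-trans _ _ _ (q , u , l) y≤z = q , u , y≤z l

≤-<-trans : ∀ x y z → x ≤ y → y < z → x < z
≤-<-trans x y _ x≤y (q , u , l) with U-open y u
... | p , p<q , u′ with located x p<q
...   | inj₁ lx = contradiction (x≤y lx , u′) (disjoint y)
...   | inj₂ ux = q , ux , l

-- Locating `y` between `q` and a larger `r` still below `x` settles it: `U y r` would witness
-- `y < x`.
≮⇒≥ : ∀ x y → ¬ y < x → x ≤ y
≮⇒≥ x y y≮x lx with L-open x lx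
... | r , q<r , lx′ with located y q<r
...   | inj₁ ly = ly
...   | inj₂ uy = contradiction (r , uy , lx′) y≮x

<-irrefl : ∀ x → ¬ x < x
<-irrefl x (_ , u , l) = disjoint x (l , u)

<-trans : ∀ x y z → x < y → y < z → x < z
<-trans x y _ (q , ux , ly) (r , uy , lz) with ℚₚ.<-cmp q r
... | tri< q<r _ _  = r , U-up x q<r ux , lz
... | tri≈ _ refl _ = contradiction (ly , uy) (disjoint y)
... | tri> _ _ r<q  = contradiction (L-down y r<q ly , uy) (disjoint y)

<-⊓ : ∀ x y z → z < x → z < y → z < x ⊓ y
<-⊓ x y _ (q , u , l) (r , u′ , l′) with ℚₚ.<-cmp q r
... | tri< q<r _ _  = q , u , l , L-down y q<r l′
... | tri≈ _ refl _ = q , u , l , l′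
... | tri> _ _ r<q  = r , u′ , L-down x r<q l , l′

-- Minimal elements and size bounds in finite sets.

minimal : ExcludedMiddle 0ℓ → ∀ {B : Set} → Finite B → {_⊏_ : Rel B 0ℓ} →
          Irreflexive _≡_ _⊏_ → Transitive _⊏_ → {P : Pred B 0ℓ} → ∃ P →
          ∃ λ m → P m × (∀ {y} → P y → ¬ y ⊏ m)
minimal em {B} (n , B↔Fin) {_⊏_} irrefl ⊏-trans {P} (x , px) =
  descend (subst P (sym (strictlyInverseʳ x)) px) (wellFounded (to x))
  where
  open Inverse B↔Fin

  wellFounded : WellFounded (λ i j → from i ⊏ from j)
  wellFounded = spo-wellFounded record
    { isEquivalence = isEquivalence
    ; irrefl        = λ { refl → irrefl refl }
    ; trans         = ⊏-trans
    ; <-resp-≈      = (λ { refl → id }) , (λ { refl → id })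
    }

  descend : ∀ {i} → P (from i) → Acc (λ i j → from i ⊏ from j) i →
            ∃ λ m → P m × (∀ {y} → P y → ¬ y ⊏ m)
  descend {i} pi (acc rec) with em {∃ λ j → P (from j) × from j ⊏ from i}
  ... | yes (j , pj , j⊏i) = descend pj (rec j⊏i)
  ... | no none = from i , pi , λ {y} py y⊏i → none
          ( to y , subst P (sym (strictlyInverseʳ y)) py
          , subst (_⊏ from i) (sym (strictlyInverseʳ y)) y⊏i )

-- The function may repeat values and leave `S`, so this is an upper bound on the size that every
-- subset inherits at once.
Covered : {V : Set} → ℕ → Pred V 0ℓ → Set
Covered {V} n S = ∃ λ (f : Fin n → V) → ∀ {s} → S s → ∃ λ i → f i ≡ s

Covered-remove : ∀ {V : Set} {n} {S S′ : Pred V 0ℓ} {b} → Covered (suc n) S →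
                 S b → S′ ⊆ S → ¬ S′ b → Covered n S′
Covered-remove {S′ = S′} (f , cover) sb S′⊆S b∉S′ with cover sb
... | i , refl = f ∘ punchIn i , λ s∈S′ → find s∈S′ (cover (S′⊆S s∈S′))
  where
  find : ∀ {s} → S′ s → (∃ λ j → f j ≡ s) → ∃ λ j → f (punchIn i j) ≡ s
  find s∈S′ (j , refl) = punchOut i≢j , cong f (punchIn-punchOut i≢j)
    where
    i≢j : i ≢ j
    i≢j refl = b∉S′ s∈S′

-- Runs and the walks they spell.

-- A run from (a , b) to (c , d) is a sequence a, b, …, c, d all of whose
-- consecutive triples lie in B.
data Run {V : Set} (B : V → V → V → Set) (a b : V) : V → V → Set where
  stop : Run B a b a b
  step : ∀ {c d e} → B a b c → Run B b c d e → Run B a b d e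

data Inner {V : Set} {B : V → V → V → Set} : ∀ {a b c d : V} → Run B a b c d → Pred V 0ℓ where
  here  : ∀ {a b c d e} {β : B a b c} {r : Run B b c d e} → Inner (step β r) b
  there : ∀ {a b c d e x} {β : B a b c} {r : Run B b c d e} → Inner r x → Inner (step β r) x

module _ {V : Set} {B : V → V → V → Set} where

  infixr 5 _++_

  -- The runs overlap in the pair `c`, `d`, so every triple across the seam already belongs to one
  -- of them.
  _++_ : ∀ {a b c d e f} → Run B a b c d → Run B c d e f → Run B a b e f
  stop     ++ s = s
  step β r ++ s = step β (r ++ s)

  Inner-++ˡ : ∀ {a b c d e f x} (r : Run B a b c d) {s : Run B c d e f} →
              Inner r x → Inner (r ++ s) x
  Inner-++ˡ (step β r) here      = here
  Inner-++ˡ (step β r) (there i) = there (Inner-++ˡ r i)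

  Inner-++ʳ : ∀ {a b c d e f x} (r : Run B a b c d) {s : Run B c d e f} →
              Inner s x → Inner (r ++ s) x
  Inner-++ʳ stop       i = i
  Inner-++ʳ (step β r) i = there (Inner-++ʳ r i)

  Run-map : ∀ {B′ : V → V → V → Set} {a b c d} → (∀ {y v z} → B y v z → B′ y v z) →
            Run B a b c d → Run B′ a b c d
  Run-map f stop       = stop
  Run-map f (step β r) = step (f β) (Run-map f r)

  last-step : ∀ {a b c d e} → B a b c → Run B b c d e → ∃ λ y → B y d e
  last-step β stop       = _ , β
  last-step _ (step β r) = last-step β r

  module _ (B-sym : ∀ {y v z} → B y v z → B z v y) where

    Run-reverse : ∀ {a b c d} → Run B a b c d → Run B d c b a
    Run-reverse stop       = stop
    Run-reverse (step β r) = Run-reverse r ++ step (B-sym β) stop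

    Inner-reverse : ∀ {a b c d x} (r : Run B a b c d) → Inner r x → Inner (Run-reverse r) x
    Inner-reverse (step β r) here      = Inner-++ʳ (Run-reverse r) here
    Inner-reverse (step β r) (there i) = Inner-++ˡ (Run-reverse r) (Inner-reverse r i)

  internals : ∀ {a b c d} → Run B a b c d → ℕ
  internals stop       = 0
  internals (step β r) = suc (internals r)

  vertex : ∀ {a b c d} (r : Run B a b c d) → Fin (2 ℕ.+ internals r) → V
  vertex {a = a} r       zero          = a
  vertex {b = b} r       (suc zero)    = b
  vertex (step β r)      (suc (suc i)) = vertex r (suc i)

  walk : ∀ {a b c d} → Run B a b c d → Walk V
  walk r = record { internals = internals r ; vertex = vertex r }

  Inner⇒I : ∀ {a b c d x} {r : Run B a b c d} → Inner r x → I[ walk r ] x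
  Inner⇒I here      = zero , refl
  Inner⇒I (there j) with Inner⇒I j
  ... | i , eq = suc i , eq

  V⇒end⊎Inner : ∀ {a b c d x} (r : Run B a b c d) → V[ walk r ] x →
                x ≡ a ⊎ Inner r x ⊎ x ≡ d
  V⇒end⊎Inner r          (zero , refl)        = inj₁ refl
  V⇒end⊎Inner stop       (suc zero , refl)    = inj₂ (inj₂ refl)
  V⇒end⊎Inner (step β r) (suc zero , refl)    = inj₂ (inj₁ here)
  V⇒end⊎Inner (step β r) (suc (suc i) , refl) with V⇒end⊎Inner r (suc i , refl)
  ... | inj₁ eq          = inj₂ (inj₁ (subst (Inner (step β r)) (sym eq) here))
  ... | inj₂ (inj₁ j)    = inj₂ (inj₁ (there j))
  ... | inj₂ (inj₂ eq)   = inj₂ (inj₂ eq)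

record Traversal {V : Set} (B : V → V → V → Set) (X C : Pred V 0ℓ) : Set where
  constructor traversal
  field
    {start second penultimate end} : V
    run           : Run B start second penultimate end
    start∈        : X start
    second∈       : C second
    penultimate∈  : C penultimate
    end∈          : X end

module _ {V : Set} {B B′ : V → V → V → Set} {X X′ C C′ : Pred V 0ℓ} where

  Traversal-map : (∀ {y v z} → B y v z → B′ y v z) → X ⊆ X′ → C ⊆ C′ →
                  Traversal B X C → Traversal B′ X′ C′
  Traversal-map f g h (traversal run x∈ k∈ k′∈ x′∈) =
    traversal (Run-map f run) (g x∈) (h k∈) (h k′∈) (g x′∈)

-- Components and minimal separators.

infix 5 _∣_

_∣_ : {V : Set} → Rel V 0ℓ → Pred V 0ℓ → Rel V 0ℓ
(E ∣ P) u v = P u × E u v × P v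

Component : {V : Set} → Rel V 0ℓ → Pred V 0ℓ → V → Pred V 0ℓ
Component E P b p = P b × Star (E ∣ P) b p

module _ {V : Set} {E : Rel V 0ℓ} {P : Pred V 0ℓ} {b : V} where

  Component-⊆ : Component E P b ⊆ P
  Component-⊆ (pb , ε)                   = pb
  Component-⊆ (_  , (_ , _ , pv) ◅ path) = along pv path
    where
    along : ∀ {v p} → P v → Star (E ∣ P) v p → P p
    along pv ε                   = pv
    along _  ((_ , _ , pw) ◅ ps) = along pw ps

  Component-closed : ∀ {p q} → Component E P b p → E p q → P q → Component E P b q
  Component-closed comp e pq =
    proj₁ comp , proj₂ comp ◅◅ (Component-⊆ comp , e , pq) ◅ ε

  -- Both points are joined through `b` by paths in `P`, and closure keeps each vertex of such a
  -- path in the component.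
  Component-connected : (∀ {u v} → E u v → E v u) → ∀ {p q} →
    Component E P b p → Component E P b q → Star (E ∣ Component E P b) p q
  Component-connected E-sym {p} cp (_ , path) =
    lift cp (reverse (λ (pu , e , pv) → pv , E-sym e , pu) (proj₂ cp) ◅◅ path)
    where
    lift : ∀ {u v} → Component E P b u → Star (E ∣ P) u v → Star (E ∣ Component E P b) u v
    lift cu ε                   = ε
    lift cu ((_ , e , pw) ◅ ps) = (cu , e , cw) ◅ lift cw ps
      where cw = Component-closed cu e pw

-- K is one of the two components K, K′ on either side of the minimal
-- separator Q of the graph (S , E).
record Side {V : Set} (S : Pred V 0ℓ) (E : Rel V 0ℓ) (K K′ Q : Pred V 0ℓ) : Set where
  field
    K⊆S       : K ⊆ S
    Q⊆S       : Q ⊆ S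
    disjointQ : ∀ {p} → K p → ¬ Q p
    separated : ∀ {p p′} → K p → K′ p′ → p ≢ p′ × ¬ E p p′
    boundary  : ∀ {p q} → K p → S q → E p q → K q ⊎ Q q
    full      : ∀ {q} → Q q → ∃ λ p → K p × E q p
    connected : ∀ {p q} → K p → K q → Star (E ∣ K) p q

module _ (em : ExcludedMiddle 0ℓ) {V : Set} {S : Pred V 0ℓ} {E : Rel V 0ℓ}
         (E-sym : ∀ {u v} → E u v → E v u) where

  -- `Far` is the component of `b` among the non-neighbours of `a`, `Q` its outer boundary, and
  -- `Near` the component of `a` once `Q` is removed. Every vertex of `Q` has a neighbour in `Far`
  -- by definition and is adjacent to `a` by maximality of `Far`, so `Q` is full on both sides.
  separate : ∀ {a b} → S a → S b → b ≢ a → ¬ E a b →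
    ∃ λ K → ∃₂ λ K′ Q → Side S E K K′ Q × Side S E K′ K Q × K a × K′ b
  separate {a} {b} sa sb b≢a ¬ab =
    Near , Far , Q , near , far , ((sa , ¬Qa) , ε) , ((sb , b≢a , ¬ab) , ε)
    where
    NonNeighbour Far Q Near : Pred V 0ℓ
    NonNeighbour p = S p × p ≢ a × ¬ E a p
    Far            = Component E NonNeighbour b
    Q q            = S q × ¬ Far q × (∃ λ p → Far p × E q p)
    Near           = Component E (λ p → S p × ¬ Q p) a

    ¬Qa : ¬ Q a
    ¬Qa (_ , _ , p , fp , e) = proj₂ (proj₂ (Component-⊆ fp)) e

    Q⇒neighbour : ∀ {q} → Q q → E a q
    Q⇒neighbour (sq , ¬fq , p , fp , e) = decidable-stable em λ ¬aq →
      ¬fq (Component-closed fp (E-sym e)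
            (sq , (λ { refl → proj₂ (proj₂ (Component-⊆ fp)) e }) , ¬aq))

    ¬Far : ∀ {p} → Near p → ¬ Far p
    -- The last vertex before a path enters `Far` would lie in `Q`, which the path avoids.
    ¬Far (_ , path) = along path (λ fa → proj₁ (proj₂ (Component-⊆ fa)) refl)
      where
      along : ∀ {u v} → Star (E ∣ (λ p → S p × ¬ Q p)) u v → ¬ Far u → ¬ Far v
      along ε                               ¬fu = ¬fu
      along (((su , ¬qu) , e , _) ◅ path) ¬fu =
        along path λ fv → ¬qu (su , ¬fu , _ , fv , e)

    apart : ∀ {p q} → Near p → Far q → p ≢ q × ¬ E p q
    apart np fq = (λ { refl → ¬Far np fq })
                , λ e → proj₂ (Component-⊆ np) (proj₁ (Component-⊆ np) , ¬Far np , _ , fq , e)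

    near : Side S E Near Far Q
    near = record
      { K⊆S       = proj₁ ∘ Component-⊆
      ; Q⊆S       = proj₁
      ; disjointQ = proj₂ ∘ Component-⊆
      ; separated = apart
      ; boundary  = λ {p} {q} np sq e → nearBoundary np sq e em
      ; full      = λ qq → a , ((sa , ¬Qa) , ε) , E-sym (Q⇒neighbour qq)
      ; connected = Component-connected E-sym
      }
      where
      nearBoundary : ∀ {p q} → Near p → S q → E p q → Dec (Q q) → Near q ⊎ Q q
      nearBoundary np sq e (yes qq) = inj₂ qq
      nearBoundary np sq e (no ¬qq) = inj₁ (Component-closed np e (sq , ¬qq))

    far : Side S E Far Near Q
    far = record
      { K⊆S       = proj₁ ∘ Component-⊆
      ; Q⊆S       = proj₁
      ; disjointQ = λ fp qp → proj₁ (proj₂ qp) fp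
      ; separated = λ fp np → (λ { refl → ¬Far np fp }) , proj₂ (apart np fp) ∘ E-sym
      ; boundary  = λ fp sq e → farBoundary fp sq e em
      ; full      = proj₂ ∘ proj₂
      ; connected = Component-connected E-sym
      }
      where
      farBoundary : ∀ {p q} → Far p → S q → E p q → Dec (Far q) → Far q ⊎ Q q
      farBoundary fp sq e (yes fq) = inj₁ fq
      farBoundary fp sq e (no ¬fq) = inj₂ (sq , ¬fq , _ , fp , E-sym e)

  -- Induced paths through a component to a target.

  module InducedPath (K P T : Pred V 0ℓ) where

    -- Chords are excluded only between vertices two steps apart, which is all that chordlessness of
    -- a walk asks. The first vertex of a run may lie outside `K`, on the separator.
    InducedStep : V → V → V → Set
    InducedStep y v z = y ≢ z × ¬ E y z × E y v × E v z × K z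

    record Approach (p : V) : Set where
      constructor approach
      field
        {next beforeLast last} : V
        edge        : E p next
        next∈       : K next
        path        : Run InducedStep p next beforeLast last
        beforeLast∈ : P beforeLast
        last∈       : T last

    -- The path is shortened wherever prepending `p` breaks inducedness: if `p` recurs as `r`, the
    -- detour is cut out; if `p` is adjacent to `r`, then `q` is skipped and the test repeated on
    -- the shorter path; otherwise `p`, `q`, `r` is an induced step.
    cons : ∀ {p q c r t} → P p → E p q → K q → E q r → K r →
           Run InducedStep q r c t → P c → T t → T p ⊎ Approach p
    cons {p} {r = r} pp pq kq qr kr path pc t∈ with em {p ≡ r} | em {E p r}
    cons pp pq kq qr kr stop pc t∈ | yes refl | _ = inj₁ t∈
    cons pp pq kq qr kr (step (_ , _ , _ , rs , ks) path) pc t∈ | yes refl | _ =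
      inj₂ (approach rs ks path pc t∈)
    cons pp pq kq qr kr stop pc t∈ | no _ | yes pr = inj₂ (approach pr kr stop pp t∈)
    cons pp pq kq qr kr (step (_ , _ , _ , rs , ks) path) pc t∈ | no _ | yes pr =
      cons pp pr kr rs ks path pc t∈
    cons pp pq kq qr kr path pc t∈ | no p≢r | no ¬pr =
      inj₂ (approach pq kq (step (p≢r , ¬pr , pq , qr , kr) path) pc t∈)

    cons′ : ∀ {p q} → P p → E p q → K q → T q ⊎ Approach q → T p ⊎ Approach p
    cons′ pp pq kq (inj₁ tq)                          = inj₂ (approach pq kq stop pp tq)
    cons′ pp pq kq (inj₂ (approach qr kr path pc t∈)) = cons pp pq kq qr kr path pc t∈

    module _ (K∖T⊆P : ∀ {p} → K p → ¬ T p → P p) where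

      -- Stopping at the first vertex of `T` keeps all earlier vertices in `P`, so whichever of them
      -- ends up next to last after shortcuts lies in `P`.
      reach : ∀ {p t} → T t → Star (E ∣ K) p t → T p ⊎ Approach p
      reach t∈ ε = inj₁ t∈
      reach {p} t∈ ((kp , e , kq) ◅ path) with em {T p}
      ... | yes tp = inj₁ tp
      ... | no ¬tp = cons′ (K∖T⊆P kp ¬tp) e kq (reach t∈ path)

      attach : ∀ {K′ Q q t} → Side S E K K′ Q → Q q → ¬ T q → P q → K t → T t → Approach q
      attach side qq ¬tq pq kt t∈ with Side.full side qq
      ... | p , kp , e with cons′ pq e kp (reach t∈ (Side.connected side kp kt))
      ...   | inj₁ tq  = contradiction tq ¬tq
      ...   | inj₂ app = app

-- Bumps and the threshold graph.

module _ (em : ExcludedMiddle 0ℓ) {V : Set} (finite : Finite V) (A : Matrix V)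
         (A-sym : Symmetric A) where

  -- v cannot precede both y and z in a perfect elimination ordering.
  record Bump (S : Pred V 0ℓ) (y v z : V) : Set where
    constructor bump
    field
      left∈    : S y
      centre∈  : S v
      right∈   : S z
      distinct : y ≢ z
      lowˡ     : A y z < A y v
      lowʳ     : A y z < A z v

  Bump-sym : ∀ {S y v z} → Bump S y v z → Bump S z v y
  Bump-sym {y = y} {z = z} (bump sy sv sz y≢z p q) =
    bump sz sv sy (y≢z ∘ sym) (swap (A z _) q) (swap (A y _) p)
    where
    swap : ∀ w → A y z < w → A z y < w
    swap w = ≤-<-trans (A z y) (A y z) w (proj₁ (A-sym z y))

  -- If `y` were the centre, `lowʳ` would compare `A y z` with `A z y`, which agree by symmetry.
  Bump-left≢centre : ∀ {S y v z} → Bump S y v z → y ≢ v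
  Bump-left≢centre {y = y} {z = z} (bump _ _ _ _ _ q) refl =
    <-irrefl (A y z) (<-≤-trans (A y z) (A z y) (A y z) q (proj₁ (A-sym z y)))

  Bump-mono : ∀ {S S′} → S ⊆ S′ → ∀ {y v z} → Bump S y v z → Bump S′ y v z
  Bump-mono S⊆S′ (bump sy sv sz y≢z p q) = bump (S⊆S′ sy) (S⊆S′ sv) (S⊆S′ sz) y≢z p q

  record Above (l : ℝ) (u v : V) : Set where
    constructor above
    field exceeds : l < A u v

  record Threshold (S : Pred V 0ℓ) : Set where
    field
      {y₀ z₀} : V
      y₀∈     : S y₀
      z₀∈     : S z₀
      y₀≢z₀   : y₀ ≢ z₀
      least   : ∀ {y z} → S y → S z → y ≢ z → ¬ A y z < A y₀ z₀

    -- By minimality of A y₀ z₀ both legs of any bump are edges.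
    E : Rel V 0ℓ
    E = Above (A y₀ z₀)

    E-sym : ∀ {u v} → E u v → E v u
    E-sym {u} {v} (above e) = above (<-≤-trans (A y₀ z₀) (A u v) (A v u) e (proj₁ (A-sym u v)))

    -- A non-edge carries at most the least entry and an edge strictly more, so inducedness in `E`
    -- alone yields the weighted inequalities.
    non-edge⇒bump : ∀ {y v z} → S y → S v → S z → y ≢ z → ¬ E y z → E y v → E v z → Bump S y v z
    non-edge⇒bump {y} {v} {z} sy sv sz y≢z ¬yz yv vz =
      bump sy sv sz y≢z (below yv) (below (E-sym vz))
      where
      below : ∀ {u w} → E u w → A y z < A u w
      below {u} {w} (above e) =
        ≤-<-trans (A y z) (A y₀ z₀) (A u w) (≮⇒≥ (A y z) (A y₀ z₀) (¬yz ∘ above)) e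

    bump⇒edge : ∀ {y v z} → Bump S y v z → E v z
    bump⇒edge {y} {v} {z} (bump sy _ sz y≢z _ q) = E-sym (above
      (≤-<-trans (A y₀ z₀) (A y z) (A z v) (≮⇒≥ (A y₀ z₀) (A y z) (least sy sz y≢z)) q))

  threshold : ∀ {S y z} → S y → S z → y ≢ z → Threshold S
  threshold {S} {y} {z} sy sz y≢z
    with minimal em finite² {λ (y , z) (y′ , z′) → A y z < A y′ z′}
           (λ { {y , z} refl → <-irrefl (A y z) })
           (λ {(y , z)} {(y′ , z′)} {(y″ , z″)} → <-trans (A y z) (A y′ z′) (A y″ z″))
           {λ (y , z) → S y × S z × y ≢ z} ((y , z) , sy , sz , y≢z)
    where
    finite² : Finite (V × V)
    finite² = _ , ↔-trans (proj₂ finite ×-↔ proj₂ finite) (↔-sym *↔×)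
  ... | (y₀ , z₀) , (sy₀ , sz₀ , y₀≢z₀) , least = record
    { y₀∈ = sy₀ ; z₀∈ = sz₀ ; y₀≢z₀ = y₀≢z₀
    ; least = λ sy sz y≢z → least (sy , sz , y≢z) }

  walk-chordless : ∀ {S a b c d} (r : Run (Bump S) a b c d) → WeightedChordless A (walk r)
  walk-chordless {a = a} {b} (step {c = c} (bump _ _ _ a≢c p q) r) zero =
    a≢c , <-⊓ (A a b) (A c b) (A a c) p q
  walk-chordless (step _ r@(step _ _)) (suc zero)    = walk-chordless r zero
  walk-chordless (step _ r@(step _ _)) (suc (suc i)) = walk-chordless r (suc i)

  -- The base point of a closed walk is its only vertex that may fail to be internal, and the other
  -- walk supplies it.
  closed-pair : ∀ {S t t′ b c b′ c′} (r : Run (Bump S) t b c t) (r′ : Run (Bump S) t′ b′ c′ t′) →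
                Inner r t′ → Inner r′ t → HasSelfContainedPair A
  closed-pair {t = t} {t′} r r′ t′∈r t∈r′ =
    walk r , walk r′ , walk-chordless r , walk-chordless r′ , V⊆I , I⊆V
    where
    V⊆I : V[ walk r ] ∪ V[ walk r′ ] ⊆ I[ walk r ] ∪ I[ walk r′ ]
    V⊆I (inj₁ v) with V⇒end⊎Inner r v
    ... | inj₁ refl        = inj₂ (Inner⇒I t∈r′)
    ... | inj₂ (inj₁ i)    = inj₁ (Inner⇒I i)
    ... | inj₂ (inj₂ refl) = inj₂ (Inner⇒I t∈r′)
    V⊆I (inj₂ v) with V⇒end⊎Inner r′ v
    ... | inj₁ refl        = inj₁ (Inner⇒I t′∈r)
    ... | inj₂ (inj₁ i)    = inj₂ (Inner⇒I i)
    ... | inj₂ (inj₂ refl) = inj₁ (Inner⇒I t′∈r)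

    I⊆V : I[ walk r ] ∪ I[ walk r′ ] ⊆ V[ walk r ] ∪ V[ walk r′ ]
    I⊆V (inj₁ (i , eq)) = inj₁ (suc (inject₁ i) , eq)
    I⊆V (inj₂ (i , eq)) = inj₂ (suc (inject₁ i) , eq)

  -- Prolonging walks across a minimal separator.

  module _ {S : Pred V 0ℓ} (θ : Threshold S) {K K′ Q : Pred V 0ℓ}
           (side : Side S (Threshold.E θ) K K′ Q) (side′ : Side S (Threshold.E θ) K′ K Q) where

    open Threshold θ
    open Side

    module _ (P T : Pred V 0ℓ) (K′∖T⊆P : ∀ {p} → K′ p → ¬ T p → P p) where

      open InducedPath em {V} {S} {E} E-sym K′ P T

      -- The continuation beyond q consists of bumps since K and K′ are not adjacent
      -- and the path inside K′ is induced.
      extend : ∀ {x k k′ q t} (r : Run (Bump S) x k k′ q) → K k′ → E k′ q → Q q → ¬ T q → P q →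
               K′ t → T t →
               ∃₂ λ c t′ → ∃ λ (r′ : Run (Bump S) x k c t′) → P c × T t′ × Inner r ⊆ Inner r′
      extend {k′ = k′} {q} r kk′ k′q qq ¬tq pq k′t t∈
        with attach K′∖T⊆P side′ qq ¬tq pq k′t t∈
      ... | approach qp k′p path pc t′∈ =
        _ , _ , r ++ step junction (bumps (Q⊆S side qq) (K⊆S side′ k′p) path) , pc , t′∈ , Inner-++ˡ r
        where
        junction = non-edge⇒bump (K⊆S side kk′) (Q⊆S side qq) (K⊆S side′ k′p)
          (proj₁ (separated side kk′ k′p)) (proj₂ (separated side kk′ k′p)) k′q qp

        bumps : ∀ {a b c d} → S a → S b → Run InducedStep a b c d → Run (Bump S) a b c d
        bumps sa sb stop = stop
        bumps sa sb (step (y≢z , ¬yz , yv , vz , kz) r) =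
          step (non-edge⇒bump sa sb (K⊆S side′ kz) y≢z ¬yz yv vz) (bumps sb (K⊆S side′ kz) r)

    -- Both ends are prolonged to the single target `t`, one after a reversal; the old second vertex
    -- stays internal throughout.
    close : ∀ {t} → K′ t → (τ : Traversal (Bump S) Q K) →
            ∃₂ λ b c → ∃ λ (r : Run (Bump S) t b c t) → Inner r (Traversal.second τ)
    close k′t (traversal stop _ k∈ _ q∈) = contradiction q∈ (disjointQ side k∈)
    close {t} k′t (traversal (step β r) q∈ k∈ k′∈ q′∈)
      with extend (λ _ → ⊤) (_≡ t) (λ _ _ → tt) (step β r) k′∈ (bump⇒edge (proj₂ (last-step β r))) q′∈
             (λ { refl → disjointQ side′ k′t q′∈ }) tt k′t refl
    ... | _ , _ , r₁ , _ , refl , mono₁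
      with extend (λ _ → ⊤) (_≡ t) (λ _ _ → tt) (Run-reverse Bump-sym r₁) k∈ (bump⇒edge (Bump-sym β)) q∈
             (λ { refl → disjointQ side′ k′t q∈ }) tt k′t refl
    ... | _ , _ , r₂ , _ , refl , mono₂ =
      _ , _ , r₂ , mono₂ (Inner-reverse Bump-sym r₁ (mono₁ here))

  module _ {C X : Pred V 0ℓ} (C∩X≡∅ : ∀ {p} → C p → ¬ X p) (θ : Threshold (C ∪ X))
           {K K′ Q : Pred V 0ℓ} (side : Side (C ∪ X) (Threshold.E θ) K K′ Q)
           (side′ : Side (C ∪ X) (Threshold.E θ) K′ K Q) where

    open Threshold θ
    open Side

    -- An end outside `X` lies in `Q` and in `C`, and is continued through `K′` to a vertex of `X`.
    -- Vertices of `K′` outside `X` belong to `C`, which controls the new penultimate vertex.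
    settle : ∀ {x k k′ q t} → Run (Bump (C ∪ X)) x k k′ q → (C ∩ K) k′ → E k′ q →
             ((X ∩ K) ∪ Q) q → K′ t → X t →
             ∃₂ λ c t′ → Run (Bump (C ∪ X)) x k c t′ × C c × X t′
    settle r (ck′ , _) _ (inj₁ (xq , _)) _ _ = _ , _ , r , ck′ , xq
    settle {q = q} r (ck′ , kk′) k′q (inj₂ qq) k′t xt with em {X q} | Q⊆S side qq
    ... | yes xq | _       = _ , _ , r , ck′ , xq
    ... | no ¬xq | inj₂ xq = contradiction xq ¬xq
    ... | no ¬xq | inj₁ cq
      with extend θ side side′ C X (λ k′p ¬xp → [ id , (λ xp → contradiction xp ¬xp) ]′ (K⊆S side′ k′p))
             r kk′ k′q qq ¬xq cq k′t xt
    ... | _ , _ , r′ , cc , xt′ , _ = _ , _ , r′ , cc , xt′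

    settle-both : ∀ {t} → K′ t → X t → Traversal (Bump (C ∪ X)) ((X ∩ K) ∪ Q) (C ∩ K) →
                  Traversal (Bump (C ∪ X)) X C
    -- In a run without inner vertices the end is also the second vertex, so it would lie in both
    -- `C ∩ K` and `(X ∩ K) ∪ Q`.
    settle-both k′t xt (traversal stop _ (ck , _) _ (inj₁ (xk , _))) = contradiction xk (C∩X≡∅ ck)
    settle-both k′t xt (traversal stop _ (_ , kk) _ (inj₂ qk)) = contradiction qk (disjointQ side kk)
    settle-both k′t xt (traversal (step β r) q∈ k∈ k′∈ q′∈)
      with settle (step β r) k′∈ (bump⇒edge (proj₂ (last-step β r))) q′∈ k′t xt
    ... | _ , _ , r₁ , cc , xt₁
      with settle (Run-reverse Bump-sym r₁) k∈ (bump⇒edge (Bump-sym β)) q∈ k′t xt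
    ... | _ , _ , r₂ , cd , xt₂ = traversal r₂ xt₁ cc cd xt₂

  -- The induction over separators.

  module _ (no-pair : ¬ HasSelfContainedPair A) where

    traverse : ∀ n {C X : Pred V 0ℓ} → Covered n (C ∪ X) → (∀ {p} → C p → ¬ X p) → ∃ C →
               (∀ {c} → C c → ∃₂ λ y z → Bump (C ∪ X) y c z) → Traversal (Bump (C ∪ X)) X C
    traverse zero (_ , cover) _ (_ , cc) _ with cover (inj₁ cc)
    ... | () , _
    traverse (suc n) {C} {X} covered C∩X≡∅ (c , cc) bumps = split initial em
      where
      S = C ∪ X

      initial : Threshold S
      initial with bumps cc
      ... | _ , _ , bump sy _ sz y≢z _ _ = threshold sy sz y≢z

      module _ (θ : Threshold S) where

        open Threshold θ
        open Side

        -- The vertex `b` lies beyond the separator, hence outside the new set, so the size bound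
        -- drops to `n`.
        traverse-side : ∀ {K K′ Q b} → Side S E K K′ Q → Side S E K′ K Q → S b → K′ b → ∃ (C ∩ K) →
                        Traversal (Bump S) ((X ∩ K) ∪ Q) (C ∩ K)
        traverse-side {K} {K′} {Q} {b} side side′ sb k′b nonempty =
          Traversal-map (Bump-mono ⊆S) id id
            (traverse n (Covered-remove covered sb ⊆S b∉) apart nonempty bumps′)
          where
          S′ = (C ∩ K) ∪ ((X ∩ K) ∪ Q)

          ⊆S : S′ ⊆ S
          ⊆S (inj₁ (cp , _))        = inj₁ cp
          ⊆S (inj₂ (inj₁ (xp , _))) = inj₂ xp
          ⊆S (inj₂ (inj₂ qp))       = Q⊆S side qp

          b∉ : ¬ S′ b
          b∉ (inj₁ (_ , kb))        = proj₁ (separated side kb k′b) refl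
          b∉ (inj₂ (inj₁ (_ , kb))) = proj₁ (separated side kb k′b) refl
          b∉ (inj₂ (inj₂ qb))       = disjointQ side′ k′b qb

          apart : ∀ {p} → (C ∩ K) p → ¬ ((X ∩ K) ∪ Q) p
          apart (cp , _) (inj₁ (xp , _)) = C∩X≡∅ cp xp
          apart (_ , kp) (inj₂ qp)       = disjointQ side kp qp

          inside : ∀ {c y} → K c → S y → E c y → S′ y
          inside kc sy cy with boundary side kc sy cy | sy
          ... | inj₂ qy | _       = inj₂ (inj₂ qy)
          ... | inj₁ ky | inj₁ c∈ = inj₁ (c∈ , ky)
          ... | inj₁ ky | inj₂ xy = inj₂ (inj₁ (xy , ky))

          bumps′ : ∀ {c} → (C ∩ K) c → ∃₂ λ y z → Bump S′ y c z
          bumps′ (cc , kc) with bumps cc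
          ... | y , z , β@(bump sy _ sz y≢z p q) =
            y , z , bump (inside kc sy (bump⇒edge (Bump-sym β))) (inj₁ (cc , kc))
                         (inside kc sz (bump⇒edge β)) y≢z p q

        split : Dec (∃₂ λ a b → C a × S b × b ≢ a × ¬ E a b) → Traversal (Bump S) X C
        split (no none) = traversal (step β stop) xy₀ cc cc xz₀
          where
          adjacent : ∀ {a b} → C a → S b → b ≢ a → E a b
          adjacent ca sb b≢a = decidable-stable em λ ¬ab → none (_ , _ , ca , sb , b≢a , ¬ab)

          -- The least entry does not exceed itself, so `y₀`, `z₀` is a non-edge; universality of
          -- `C` then puts both in `X`.
          ¬y₀z₀ : ¬ E y₀ z₀
          ¬y₀z₀ = <-irrefl (A y₀ z₀) ∘ Above.exceeds

          xy₀ : X y₀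
          xy₀ = [ (λ cy₀ → contradiction (adjacent cy₀ z₀∈ (y₀≢z₀ ∘ sym)) ¬y₀z₀) , id ]′ y₀∈

          xz₀ : X z₀
          xz₀ = [ (λ cz₀ → contradiction (E-sym (adjacent cz₀ y₀∈ y₀≢z₀)) ¬y₀z₀) , id ]′ z₀∈

          β : Bump S y₀ c z₀
          β = non-edge⇒bump y₀∈ (inj₁ cc) z₀∈ y₀≢z₀ ¬y₀z₀
            (E-sym (adjacent cc y₀∈ λ { refl → C∩X≡∅ cc xy₀ }))
            (adjacent cc z₀∈ λ { refl → C∩X≡∅ cc xz₀ })
        split (yes (a , b , ca , sb , b≢a , ¬ab)) with separate em E-sym (inj₁ ca) sb b≢a ¬ab
        ... | K , K′ , Q , side , side′ , ka , k′b = cases em em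
          where
          τ : Traversal (Bump S) ((X ∩ K) ∪ Q) (C ∩ K)
          τ = traverse-side side side′ sb k′b (a , ca , ka)

          -- Only `S b` is known, so it is `X` missing `K′` that places `b` in `C` and makes
          -- `C ∩ K′` nonempty.
          τ′ : ¬ ∃ (X ∩ K′) → Traversal (Bump S) ((X ∩ K′) ∪ Q) (C ∩ K′)
          τ′ none = traverse-side side′ side (inj₁ ca) ka
            (b , [ id , (λ xb → contradiction (b , xb , k′b) none) ]′ sb , k′b)

          cases : Dec (∃ (X ∩ K′)) → Dec (∃ (X ∩ K)) → Traversal (Bump S) X C
          cases (yes (_ , xt , k′t)) _ = settle-both C∩X≡∅ θ side side′ k′t xt τ
          cases (no none′) (yes (_ , xt , kt)) = settle-both C∩X≡∅ θ side′ side kt xt (τ′ none′)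
          cases (no none′) (no none) = contradiction (closed-pair r r′ k∈r k′∈r′) no-pair
            where
            toQ : ∀ {L : Pred V 0ℓ} → ¬ ∃ (X ∩ L) → (X ∩ L) ∪ Q ⊆ Q
            toQ none (inj₁ xl) = contradiction (_ , xl) none
            toQ none (inj₂ q)  = q

            σ  = Traversal-map id (toQ none) proj₂ τ
            σ′ = Traversal-map id (toQ none′) proj₂ (τ′ none′)

            -- Each closed walk is based at the second vertex of the other traversal, which the
            -- other closed walk keeps as an inner vertex.
            closed  = close θ side side′ (Traversal.second∈ σ′) σ
            closed′ = close θ side′ side (Traversal.second∈ σ) σ′
            r       = proj₁ (proj₂ (proj₂ closed))
            k∈r     = proj₂ (proj₂ (proj₂ closed))
            r′      = proj₁ (proj₂ (proj₂ closed′))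
            k′∈r′   = proj₂ (proj₂ (proj₂ closed′))

    -- From simplicial vertices to an elimination ordering.

    simplicial : ∀ {n} {S : Pred V 0ℓ} → Covered n S → ∃ S →
                 ∃ λ s → S s × (∀ {y z} → ¬ Bump S y s z)
    simplicial {n} {S} (f , cover) nonempty = decidable-stable em λ none →
      -- With `X` empty, the traversal would start in the empty set.
      Traversal.start∈ (traverse n {S} {∅} (f , λ { (inj₁ s) → cover s }) (λ _ ()) nonempty (bumps none))
      where
      bumps : ¬ (∃ λ s → S s × (∀ {y z} → ¬ Bump S y s z)) →
              ∀ {c} → S c → ∃₂ λ y z → Bump (S ∪ ∅) y c z
      bumps none {c} sc = decidable-stable em λ no-bump →
        none (c , sc , λ β → no-bump (_ , _ , Bump-mono inj₁ β))

    -- A simplicial vertex receives rank 0 and the inductively ranked rest is shifted up by one.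
    -- Ranks outside `S` are arbitrary.
    ranking : ∀ n {S : Pred V 0ℓ} → Covered n S → ∃ λ (rank : V → ℕ) →
              (∀ {x y} → S x → S y → rank x ≡ rank y → x ≡ y) ×
              (∀ {x y z} → S x → S y → S z → rank x ℕ.< rank y → rank y ℕ.< rank z →
                 A x y ⊓ A x z ≤ A y z)
    ranking n {S} covered with em {∃ S}
    ... | no empty = (λ _ → 0) , (λ sx → contradiction (_ , sx) empty) , (λ sx → contradiction (_ , sx) empty)
    ranking zero (_ , cover) | yes (_ , s∈) with cover s∈
    ... | () , _
    ranking (suc n) {S} covered | yes nonempty with simplicial covered nonempty
    ... | s , ss , no-bump
      with ranking n (Covered-remove {S′ = λ p → S p × p ≢ s} covered ss proj₁ (λ (_ , s≢s) → s≢s refl))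
    ... | rank′ , injective′ , perfect′ = (λ x → rank x em) , (λ sx sy → injective sx sy em em)
                                        , (λ sx sy sz → perfect sx sy sz em em em)
      where
      rank : ∀ x → Dec (x ≡ s) → ℕ
      rank x (yes _) = 0
      rank x (no _)  = suc (rank′ x)

      injective : ∀ {x y} → S x → S y → (dx : Dec (x ≡ s)) (dy : Dec (y ≡ s)) →
                  rank x dx ≡ rank y dy → x ≡ y
      injective sx sy (yes refl) (yes refl) _ = refl
      injective sx sy (no x≢s) (no y≢s) eq = injective′ (sx , x≢s) (sy , y≢s) (ℕₚ.suc-injective eq)

      perfect : ∀ {x y z} → S x → S y → S z →
                (dx : Dec (x ≡ s)) (dy : Dec (y ≡ s)) (dz : Dec (z ≡ s)) →
                rank x dx ℕ.< rank y dy → rank y dy ℕ.< rank z dz → A x y ⊓ A x z ≤ A y z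
      perfect sx sy sz (no x≢s) (no y≢s) (no z≢s) x<y y<z =
        perfect′ (sx , x≢s) (sy , y≢s) (sz , z≢s) (ℕ.s<s⁻¹ x<y) (ℕ.s<s⁻¹ y<z)
      -- The simplicial vertex comes first here, and a violation would make it the centre of a bump;
      -- the strict inequality of ranks gives `y ≢ z`.
      perfect {x} {y} {z} sx sy sz (yes refl) (no y≢s) (no z≢s) _ y<z =
        ≮⇒≥ (A x y ⊓ A x z) (A y z) λ yz<⊓ → no-bump
          (bump sy sx sz (λ { refl → ℕₚ.<-irrefl refl y<z })
            (<-≤-trans (A y z) (A x y) (A y x)
              (<-≤-trans (A y z) (A x y ⊓ A x z) (A x y) yz<⊓ (x⊓y≤x (A x y) (A x z))) (proj₁ (A-sym x y)))
            (<-≤-trans (A y z) (A x z) (A z x)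
              (<-≤-trans (A y z) (A x y ⊓ A x z) (A x z) yz<⊓ (x⊓y≤y (A x y) (A x z))) (proj₁ (A-sym x z))))

    elimination-ordering : HasPerfectEliminationOrdering A
    elimination-ordering with ranking (proj₁ finite) {λ _ → ⊤} (from , λ {s} _ → to s , strictlyInverseʳ s)
      where open Inverse (proj₂ finite)
    ... | rank , injective , perfect =
      (λ x y → rank x ℕ.< rank y) , isStrictTotalOrder , λ _ _ _ → perfect tt tt tt
      where
      isStrictTotalOrder : IsStrictTotalOrder _≡_ (λ x y → rank x ℕ.< rank y)
      isStrictTotalOrder = record
        { isStrictPartialOrder = record
          { isEquivalence = isEquivalence
          ; irrefl        = λ { refl → ℕₚ.<-irrefl refl }
          ; trans         = ℕₚ.<-trans
          ; <-resp-≈      = (λ { refl → id }) , (λ { refl → id })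
          }
        ; compare = compare
        }
        where
        compare : ∀ x y → _
        compare x y with ℕₚ.<-cmp (rank x) (rank y)
        ... | tri< x<y x≢y y≮x = tri< x<y (x≢y ∘ cong rank) y≮x
        ... | tri≈ x≮y x≡y y≮x = tri≈ x≮y (injective tt tt x≡y) y≮x
        ... | tri> x≮y x≢y y<x = tri> x≮y (x≢y ∘ cong rank) y<x


  -- An ordering excludes self-contained pairs.

  chordless⇒bump : ∀ W → WeightedChordless A W → ∀ i →
                   Bump (λ _ → ⊤) (Walk.prev W i) (Walk.here W i) (Walk.next W i)
  chordless⇒bump W chordless i with chordless i
  ... | p≢n , low = bump tt tt tt p≢n
          (<-≤-trans (A p n) (A p h ⊓ A n h) (A p h) low (x⊓y≤x (A p h) (A n h)))
          (<-≤-trans (A p n) (A p h ⊓ A n h) (A n h) low (x⊓y≤y (A p h) (A n h)))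
    where
    p = Walk.prev W i
    h = Walk.here W i
    n = Walk.next W i

  no-self-contained-pair : HasPerfectEliminationOrdering A → ¬ HasSelfContainedPair A
  no-self-contained-pair (_≺_ , sto , perfect) (W₁ , W₂ , chordless₁ , chordless₂ , V⊆I , _)
    with minimal em finite {_≺_} irrefl ≺-trans {V[ W₁ ] ∪ V[ W₂ ]} (_ , inj₁ (zero , refl))
    where open IsStrictTotalOrder sto using (irrefl) renaming (trans to ≺-trans)
  ... | m , m∈ , least = [ not-inner W₁ chordless₁ (least ∘ inj₁)
                         , not-inner W₂ chordless₂ (least ∘ inj₂) ]′ (V⊆I m∈)
    where
    open IsStrictTotalOrder sto using (compare)

    unordered : ∀ {S y v z} → Bump S y v z → v ≺ y → ¬ y ≺ z
    unordered {y = y} {v} {z} (bump _ _ _ _ p q) v≺y y≺z = <-irrefl (A y z)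
      (<-≤-trans (A y z) (A v y ⊓ A v z) (A y z)
        (<-⊓ (A v y) (A v z) (A y z)
          (<-≤-trans (A y z) (A y v) (A v y) p (proj₁ (A-sym y v)))
          (<-≤-trans (A y z) (A z v) (A v z) q (proj₁ (A-sym z v))))
        (perfect v y z v≺y y≺z))

    not-first : ∀ {S y v z} → Bump S y v z → v ≺ y → ¬ v ≺ z
    not-first {y = y} {z = z} β v≺y v≺z with compare y z
    ... | tri< y≺z _ _ = unordered β v≺y y≺z
    ... | tri≈ _ y≡z _ = Bump.distinct β y≡z
    ... | tri> _ _ z≺y = unordered (Bump-sym β) v≺z z≺y

    not-inner : ∀ W → WeightedChordless A W → (∀ {y} → V[ W ] y → ¬ y ≺ m) → ¬ I[ W ] m
    not-inner W chordless least (i , refl) =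
      -- Walks may repeat vertices, so both neighbours must be seen to differ from `m`; being no
      -- earlier, they then come strictly after it.
      not-first β (after (inject₁ (inject₁ i) , refl) (Bump-left≢centre β))
                  (after (suc (suc i) , refl) (Bump-left≢centre (Bump-sym β)))
      where
      β = chordless⇒bump W chordless i

      after : ∀ {y} → V[ W ] y → y ≢ m → m ≺ y
      after {y} y∈ y≢m with compare y m
      ... | tri< y≺m _ _ = contradiction y≺m (least y∈)
      ... | tri≈ _ y≡m _ = contradiction y≡m y≢m
      ... | tri> _ _ m≺y = m≺y

theorem1 : ExcludedMiddle 0ℓ →
    ∀ {V : Set} → Finite V → (A : Matrix V) → Symmetric A →
    HasPerfectEliminationOrdering A ⇔ (¬ HasSelfContainedPair A)
theorem1 em finite A A-sym =
  mk⇔ (no-self-contained-pair em finite A A-sym) (elimination-ordering em finite A A-sym)
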